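{- Let $G\le\mathrm{Sym}(m)$ and $H\le\mathrm{Sym}(n)$, each with its natural action, have the EKR property. Then the wreath product $G\wr H$, acting on $\Omega=[m]\times[n]$ by $(x,j)^{(g_1,\dots,g_n,h)}=(g_j(x),h(j))$, has the EKR property.
   Context: The wreath product $G\wr H$ has underlying set $G^n\times H$ with multiplication $(g_1,\dots,g_n,h)\cdot(g'_1,\dots,g'_n,h')=(g_1g'_{h(1)},\dots,g_ng'_{h(n)},hh')$; the displayed formula defines an action on $[m]\times[n]$. For a group $G$ acting faithfully on a finite set $\Omega$: $\pi,\sigma$ intersect if $\pi\sigma^{ -1}$ fixes a point of $\Omega$; a subset is intersecting if every pair of its elements intersect; the group has the EKR property if every intersecting subset has size at most the size of the largest point-stabilizer. -}

module Defs where

open import Level using (0ℓ)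
open import Data.Nat using (ℕ; _≤_)
open import Data.Fin using (Fin)
open import Data.Product using (Σ; ∃; ∃-syntax; _×_; _,_)
open import Data.List using (List; length)
open import Data.List.Relation.Unary.All using (All)
open import Data.List.Relation.Unary.AllPairs using (AllPairs)
open import Function.Bundles using (_↔_; Inverse)
open import Function.Construct.Identity using (↔-id)
open import Function.Construct.Composition using (_↔-∘_)
open import Function.Construct.Symmetry using (↔-sym)
open import Relation.Binary.PropositionalEquality using (_≡_)
open import Relation.Nullary using (¬_)

Sym : Set → Set
Sym Ω = Ω ↔ Ω

module _ {Ω : Set} where
  open Inverse

  _^_ : Ω → Sym Ω → Ω
  ω ^ π = to π ω

  -- product in the right-action convention: ω ^ (π · σ) = (ω ^ π) ^ σ
  _·_ : Sym Ω → Sym Ω → Sym Ω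
  π · σ = σ ↔-∘ π

  _⁻¹ : Sym Ω → Sym Ω
  π ⁻¹ = ↔-sym π

  ι : Sym Ω
  ι = ↔-id Ω

  _≈_ : Sym Ω → Sym Ω → Set
  π ≈ σ = ∀ ω → ω ^ π ≡ ω ^ σ

  _≉_ : Sym Ω → Sym Ω → Set
  π ≉ σ = ¬ (π ≈ σ)

  Fixes : Sym Ω → Ω → Set
  Fixes π ω = ω ^ π ≡ ω

  Intersect : Sym Ω → Sym Ω → Set
  Intersect π σ = ∃[ ω ] Fixes (π · (σ ⁻¹)) ω

  record IsSubgroup (G : Sym Ω → Set) : Set where
    field
      resp-≈ : ∀ {π σ} → π ≈ σ → G π → G σ
      ι-mem  : G ι
      ·-mem  : ∀ {π σ} → G π → G σ → G (π · σ)
      ⁻¹-mem : ∀ {π} → G π → G (π ⁻¹)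

  IsFinSubset : (G : Sym Ω → Set) → List (Sym Ω) → Set
  IsFinSubset G S = AllPairs _≉_ S × All G S

  IsIntersecting : List (Sym Ω) → Set
  IsIntersecting S = AllPairs Intersect S

  Stab : (G : Sym Ω → Set) → Ω → Sym Ω → Set
  Stab G ω π = G π × Fixes π ω

  -- EKR property: every intersecting subset S of G has |S| ≤ max_ω |G_ω|,
  -- i.e. there is a point ω and |S| distinct elements of G_ω.
  EKR : (G : Sym Ω → Set) → Set
  EKR G = (S : List (Sym Ω)) → IsFinSubset G S → IsIntersecting S →
          ∃[ ω ] ∃[ T ] (IsFinSubset (Stab G ω) T × length S ≤ length T)

-- The wreath product G ≀ H as a permutation group on [m] × [n]:
-- the set of permutations π with (x , j) ^ π = (g_j(x) , h(j)) for some
-- g_1..g_n ∈ G and h ∈ H (image of the faithful action).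
Wreath : {m n : ℕ} → (Sym (Fin m) → Set) → (Sym (Fin n) → Set) →
         Sym (Fin m × Fin n) → Set
Wreath {m} {n} G H π =
  Σ (Fin n → Sym (Fin m)) λ gs → ((∀ j → G (gs j)) × Σ (Sym (Fin n)) λ h → (H h ×
    (∀ (x : Fin m) (j : Fin n) → (x , j) ^ π ≡ ((x ^ gs j) , (j ^ h)))))

{-# OPTIONS --safe #-}

-- Write an element of the wreath product as (g₀,…,gₚ; h).  On the elements
-- sharing a given key (g₁g₀⁻¹,…,gₚg₀⁻¹), that is, on a coset of the diagonal
-- copy of G × H, an intersection in Ω forces both an intersection of the g₀'s in
-- G and an intersection of the h's in H.  So an intersecting family has size at
-- most  #keys · b · a  for some intersecting subsets of H and G of sizes b and a.
-- Conversely, if T_G fixes x and T_H fixes j, then placing t ∈ T_G at coordinate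
-- j, a key in the other p coordinates and h ∈ T_H on top gives
-- #keys · |T_G| · |T_H| elements fixing (x , j).  Membership in G and H need not
-- be decidable, so the keys are those occurring in the family itself.
module Submission where

open import Defs
open import Data.Nat using (ℕ)
open import Data.Fin using (Fin)
open import Level using (0ℓ; _⊔_)
open import Data.Nat using (zero; suc; _+_; _*_; _≤_; _<_; z≤n; s≤s)
open import Data.Nat.Properties using (≤-refl; ≤-trans; ≤-total; ≤-reflexive; +-suc; +-mono-≤; *-mono-≤; *-monoʳ-≤; *-comm; module ≤-Reasoning)
open import Data.Nat.Induction using (<-wellFounded)
open import Induction.WellFounded using (Acc; acc)
open import Data.Fin using (zero; suc; punchIn)
open import Data.Fin.Properties using (all?; _≟_)
open import Data.Product using (∃; ∃-syntax; _×_; _,_; proj₁; proj₂)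
open import Data.Product.Properties using (,-injectiveˡ; ,-injectiveʳ)
open import Data.Product.Relation.Binary.Pointwise.NonDependent using (×-setoid)
open import Data.Sum using (inj₁; inj₂)
open import Data.List using (List; []; _∷_; length; map; filter; cartesianProduct; cartesianProductWith)
open import Data.List.Properties using (length-map; length-filter; length-++)
open import Data.List.Membership.Propositional.Properties using (∈-cartesianProduct⁻)
open import Data.List.Relation.Unary.All as All using (All; []; _∷_)
import Data.List.Relation.Unary.All.Properties as All
open import Data.List.Relation.Unary.AllPairs as AllPairs using (AllPairs; []; _∷_)
import Data.List.Relation.Unary.AllPairs.Properties as AllPairs
import Data.List.Relation.Unary.Unique.Setoid.Properties as Unique
open import Data.List.Relation.Binary.Sublist.Propositional using (_⊆_; []; _∷_; _∷ʳ_; ⊆-trans)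
open import Data.List.Relation.Binary.Sublist.Propositional.Properties using (All-resp-⊆; filter-⊆)
open import Data.Vec.Functional using (Vector; insertAt)
open import Data.Vec.Functional.Properties using (insertAt-lookup; insertAt-punchIn)
import Data.Vec.Functional.Relation.Binary.Pointwise.Properties as Pointwise
open import Function using (_∘_; _on_)
open import Function.Bundles using (Inverse; mk↔ₛ′)
open import Relation.Binary using (Setoid; DecSetoid; Rel)
import Relation.Binary.Construct.On as On
open import Relation.Binary.PropositionalEquality using (_≡_; refl; sym; trans; cong; cong₂; subst; subst₂; setoid; module ≡-Reasoning)
open import Relation.Nullary using (¬_; yes; no)
open import Relation.Nullary.Decidable using (¬?)
import Relation.Unary as U

open Inverse using (from; strictlyInverseˡ; strictlyInverseʳ)

-- Sublists, filters and products of lists.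

AllPairs-resp-⊆ : ∀ {a ℓ} {A : Set a} {R : Rel A ℓ} {xs ys : List A} →
                  xs ⊆ ys → AllPairs R ys → AllPairs R xs
AllPairs-resp-⊆ []         []       = []
AllPairs-resp-⊆ (_ ∷ʳ s)   (_ ∷ ps) = AllPairs-resp-⊆ s ps
AllPairs-resp-⊆ (refl ∷ s) (p ∷ ps) = All-resp-⊆ s p ∷ AllPairs-resp-⊆ s ps

length-filter-¬ : ∀ {a p} {A : Set a} {P : A → Set p} (P? : U.Decidable P) xs →
                  length xs ≡ length (filter P? xs) + length (filter (¬? ∘ P?) xs)
length-filter-¬ P? []       = refl
length-filter-¬ P? (x ∷ xs) with P? x
... | yes _ = cong suc (length-filter-¬ P? xs)
... | no  _ = trans (cong suc (length-filter-¬ P? xs)) (sym (+-suc _ _))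

length-cartesianProductWith : ∀ {a b c} {A : Set a} {B : Set b} {C : Set c}
  (f : A → B → C) xs ys → length (cartesianProductWith f xs ys) ≡ length xs * length ys
length-cartesianProductWith f []       ys = refl
length-cartesianProductWith f (x ∷ xs) ys = trans
  (length-++ (map (f x) ys))
  (cong₂ _+_ (length-map (f x) ys) (length-cartesianProductWith f xs ys))

All-toList : ∀ {a p} {A : Set a} {P : A → Set p} {xs} (pxs : All P xs) →
             map proj₁ (All.toList pxs) ≡ xs
All-toList []         = refl
All-toList (px ∷ pxs) = cong (_ ∷_) (All-toList pxs)

-- A pigeonhole principle for decidable equivalences.

module _ {c ℓ} (D : DecSetoid c ℓ) where
  open DecSetoid D using (Carrier) renaming (_≈_ to _∼_; _≟_ to _∼?_; sym to ∼-sym; trans to ∼-trans)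

  All⇒AllPairs : ∀ {a xs} → All (a ∼_) xs → AllPairs _∼_ xs
  All⇒AllPairs []       = []
  All⇒AllPairs (p ∷ ps) = All.map (∼-trans (∼-sym p)) ps ∷ All⇒AllPairs ps

  -- Both lists are sublists of `xs`, so that any pairwise property of the family, such as
  -- intersecting, passes to them.
  record Pigeonhole (xs : List Carrier) : Set (c ⊔ ℓ) where
    field
      {reps class} : List Carrier
      reps-⊆       : reps ⊆ xs
      class-⊆      : class ⊆ xs
      reps-≁       : AllPairs (λ x y → ¬ x ∼ y) reps
      class-∼      : AllPairs _∼_ class
      bound        : length xs ≤ length reps * length class

  -- Split off the class of the head, treat the remaining elements recursively, and keep the longer
  -- of the two classes. The remainder is a filtered list, hence the recursion on length.
  pigeonhole : ∀ xs → Pigeonhole xs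
  pigeonhole xs = go xs (<-wellFounded _)
    where
    go : ∀ xs → Acc _<_ (length xs) → Pigeonhole xs
    go [] _ = record
      { reps-⊆ = [] ; class-⊆ = [] ; reps-≁ = [] ; class-∼ = [] ; bound = z≤n }
    go (x ∷ xs) (acc rec) = largest (≤-total (length class) (length own))
      where
      own  = x ∷ filter (x ∼?_) xs
      rest = filter (¬? ∘ (x ∼?_)) xs
      open Pigeonhole (go rest (rec (s≤s (length-filter _ xs))))

      own+rest : length (x ∷ xs) ≤ length own + length reps * length class
      own+rest = ≤-trans (≤-reflexive (cong suc (length-filter-¬ (x ∼?_) xs)))
                         (+-mono-≤ (≤-refl {length own}) bound)

      reps′-⊆ : x ∷ reps ⊆ x ∷ xs
      reps′-⊆ = refl ∷ ⊆-trans reps-⊆ (filter-⊆ _ xs)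

      reps′-≁ : AllPairs (λ y z → ¬ y ∼ z) (x ∷ reps)
      reps′-≁ = All-resp-⊆ reps-⊆ (All.all-filter _ xs) ∷ reps-≁

      -- With r representatives in the remainder, |own| + r·|class| is at most (1 + r) times the
      -- larger of |own| and |class|.
      largest : _ → Pigeonhole (x ∷ xs)
      largest (inj₁ class≤own) = record
        { reps-⊆ = reps′-⊆
        ; class-⊆ = refl ∷ filter-⊆ _ xs
        ; reps-≁ = reps′-≁
        ; class-∼ = All.all-filter _ xs ∷ All⇒AllPairs (All.all-filter _ xs)
        ; bound = ≤-trans own+rest
            (+-mono-≤ (≤-refl {length own}) (*-monoʳ-≤ (length reps) class≤own))
        }
      largest (inj₂ own≤class) = record
        { reps-⊆ = reps′-⊆
        ; class-⊆ = x ∷ʳ ⊆-trans class-⊆ (filter-⊆ _ xs)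
        ; reps-≁ = reps′-≁
        ; class-∼ = class-∼
        ; bound = ≤-trans own+rest (+-mono-≤ own≤class ≤-refl)
        }

-- Vectors of permutations, agreement at a point, and wreath permutations.

insertAt⁺ : ∀ {a p} {A : Set a} (P : A → Set p) {n} {xs : Vector A n} {v} →
            (∀ i → P (xs i)) → ∀ j → P v → ∀ i → P (insertAt xs j v i)
insertAt⁺ P             pxs zero    pv zero    = pv
insertAt⁺ P             pxs zero    pv (suc i) = pxs i
insertAt⁺ P {n = suc n} pxs (suc j) pv zero    = pxs zero
insertAt⁺ P {n = suc n} pxs (suc j) pv (suc i) = insertAt⁺ P (pxs ∘ suc) j pv i

module _ {Ω : Set} where

  intersect⇒agree : ∀ {π σ : Sym Ω} → Intersect π σ → ∃[ ω ] ω ^ π ≡ ω ^ σ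
  intersect⇒agree {σ = σ} (ω , eq) = ω , trans (sym (strictlyInverseˡ σ _)) (cong (_^ σ) eq)

  agree⇒intersect : ∀ {π σ : Sym Ω} → ∃[ ω ] ω ^ π ≡ ω ^ σ → Intersect π σ
  agree⇒intersect {σ = σ} (ω , eq) = ω , trans (cong (from σ) eq) (strictlyInverseʳ σ ω)

≈-setoid : Set → Setoid 0ℓ 0ℓ
≈-setoid Ω = record
  { Carrier       = Sym Ω
  ; _≈_           = _≈_
  ; isEquivalence = record
    { refl  = λ _ → refl
    ; sym   = λ p ω → sym (p ω)
    ; trans = λ p q ω → trans (p ω) (q ω)
    }
  }

-- Finiteness of the domain makes equality of permutations decidable; sorting a family into classes
-- relies on this alone.
≈-decSetoid : ℕ → DecSetoid 0ℓ 0ℓ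
≈-decSetoid n = record
  { isDecEquivalence = record
    { isEquivalence = Setoid.isEquivalence (≈-setoid (Fin n))
    ; _≟_           = λ π σ → all? λ ω → (ω ^ π) ≟ (ω ^ σ)
    }
  }

keySetoid : ℕ → ℕ → DecSetoid 0ℓ 0ℓ
keySetoid m p = record
  { isDecEquivalence = Pointwise.isDecEquivalence (DecSetoid.isDecEquivalence (≈-decSetoid m)) p }

wreathSym : ∀ {m n} → Vector (Sym (Fin m)) n → Sym (Fin n) → Sym (Fin m × Fin n)
wreathSym gs h = mk↔ₛ′
  (λ (x , j) → x ^ gs j , j ^ h)
  (λ (y , k) → from (gs (from h k)) y , from h k)
  (λ (y , k) → cong₂ _,_ (strictlyInverseˡ (gs (from h k)) y) (strictlyInverseˡ h k))
  (λ (x , j) → trans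
    -- The index occurs both in the choice of `gs i` and as the second component, so both are
    -- rewritten at once.
    (cong (λ i → from (gs i) (x ^ gs j) , i) (strictlyInverseʳ h j))
    (cong (_, j) (strictlyInverseʳ (gs j) x)))

-- Keys, bases and tops of wreath product elements.

module _ {m p : ℕ} (G : Sym (Fin m) → Set) (H : Sym (Fin (suc p)) → Set) (G≤ : IsSubgroup G) where
  open IsSubgroup G≤

  -- A permutation carried with a chosen decomposition, from which base, top and key are read off.
  -- Distinctness and intersection are still judged on the permutation.
  Element : Set
  Element = ∃ (Wreath G H)

  coord : Element → Vector (Sym (Fin m)) (suc p)
  coord (_ , gs , _) = gs

  base : Element → Sym (Fin m)
  base w = coord w zero

  base∈G : ∀ w → G (base w)
  base∈G (_ , _ , gs∈G , _) = gs∈G zero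

  top : Element → Sym (Fin (suc p))
  top (_ , _ , _ , h , _) = h

  top∈H : ∀ w → H (top w)
  top∈H (_ , _ , _ , _ , h∈H , _) = h∈H

  action : ∀ w x j → (x , j) ^ proj₁ w ≡ (x ^ coord w j , j ^ top w)
  action (_ , _ , _ , _ , _ , act) = act

  key : Element → Vector (Sym (Fin m)) p
  key w i = coord w (suc i) · (base w ⁻¹)

  key∈G : ∀ w i → G (key w i)
  key∈G (_ , _ , gs∈G , _) i = ·-mem (gs∈G (suc i)) (⁻¹-mem (gs∈G zero))

  SameKey SameTop Meet : Rel Element 0ℓ
  SameKey = DecSetoid._≈_ (keySetoid m p) on key
  SameTop = _≈_ on top
  Meet    = Intersect on proj₁

  key-base : ∀ w i x → x ^ coord w (suc i) ≡ (x ^ key w i) ^ base w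
  key-base w i x = sym (strictlyInverseˡ (base w) _)

  -- Every coordinate other than the base is the product of its key entry with the base.
  coord-determined : ∀ {v w} → SameKey v w → base v ≈ base w → ∀ j → coord v j ≈ coord w j
  coord-determined         k b zero    x = b x
  coord-determined {v} {w} k b (suc i) x = begin
    x ^ coord v (suc i)    ≡⟨ key-base v i x ⟩
    (x ^ key v i) ^ base v ≡⟨ b _ ⟩
    (x ^ key v i) ^ base w ≡⟨ cong (_^ base w) (k i x) ⟩
    (x ^ key w i) ^ base w ≡⟨ key-base w i x ⟨
    x ^ coord w (suc i)    ∎
    where open ≡-Reasoning

  -- Used in contrapositive form: among elements sharing key and top, distinct elements have
  -- distinct bases, so passing to bases loses nothing in size.
  element-determined : ∀ {v w} → SameKey v w → SameTop v w → base v ≈ base w → proj₁ v ≈ proj₁ w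
  element-determined {v} {w} k t b (x , j) = trans (action v x j)
    (trans (cong₂ _,_ (coord-determined {v} {w} k b j x) (t j)) (sym (action w x j)))

  meet⇒agree : ∀ {v w} → Meet v w → ∃[ j ] (j ^ top v ≡ j ^ top w × ∃[ x ] x ^ coord v j ≡ x ^ coord w j)
  meet⇒agree {v} {w} vw with intersect⇒agree {π = proj₁ v} {proj₁ w} vw
  ... | (x , j) , eq = j , ,-injectiveʳ eq′ , x , ,-injectiveˡ eq′
    where eq′ = trans (sym (action v x j)) (trans eq (action w x j))

  top-intersect : ∀ {v w} → Meet v w → Intersect (top v) (top w)
  top-intersect {v} {w} vw with meet⇒agree {v} {w} vw
  ... | j , eq , _ = agree⇒intersect {π = top v} {top w} (j , eq)

  base-intersect : ∀ {v w} → SameKey v w → Meet v w → Intersect (base v) (base w)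
  base-intersect {v} {w} k vw with meet⇒agree {v} {w} vw
  ... | zero  , _ , x , eq = agree⇒intersect {π = base v} {base w} (x , eq)
  -- Agreement at `x` in block `suc i` is moved to the base: both coordinates first apply the shared
  -- key entry, so the bases agree at the image of `x` under it.
  ... | suc i , _ , x , eq = agree⇒intersect {π = base v} {base w} (x ^ key v i , (begin
    (x ^ key v i) ^ base v ≡⟨ key-base v i x ⟨
    x ^ coord v (suc i)    ≡⟨ eq ⟩
    x ^ coord w (suc i)    ≡⟨ key-base w i x ⟩
    (x ^ key w i) ^ base w ≡⟨ cong (_^ base w) (k i x) ⟨
    (x ^ key v i) ^ base w ∎))
    where open ≡-Reasoning

  -- A large family in the stabilizer of a point.

  module _ (x : Fin m) (j : Fin (suc p)) where

    stabElement : Vector (Sym (Fin m)) p → Sym (Fin m) × Sym (Fin (suc p)) → Sym (Fin m × Fin (suc p))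
    stabElement ks (t , h) = wreathSym (insertAt ks j t) h

    stabElement-mem : ∀ {ks t h} → (∀ i → G (ks i)) → Stab G x t → Stab H j h →
                      Stab (Wreath G H) (x , j) (stabElement ks (t , h))
    stabElement-mem {ks} {t} {h} ks∈G (t∈G , xt) (h∈H , jh) =
      (insertAt ks j t , insertAt⁺ G ks∈G j t∈G , h , h∈H , λ _ _ → refl) ,
      cong₂ _,_ (trans (cong (x ^_) (insertAt-lookup ks j t)) xt) jh

    -- The action on block i recovers coordinate i. Coordinate `j` holds the element of the
    -- stabilizer in `G`, and `punchIn j` runs through the others, which hold the key.
    stabElement-injective : ∀ {ks ls th uk} → stabElement ks th ≈ stabElement ls uk →
      DecSetoid._≈_ (keySetoid m p) ks ls × (proj₁ th ≈ proj₁ uk × proj₂ th ≈ proj₂ uk)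
    stabElement-injective {ks} {ls} {t , h} {u , k} eq =
      (λ i → subst₂ _≈_ (insertAt-punchIn ks j t i) (insertAt-punchIn ls j u i) (coords (punchIn j i))) ,
      subst₂ _≈_ (insertAt-lookup ks j t) (insertAt-lookup ls j u) (coords j) ,
      -- The point `x` witnesses that block `i` is inhabited, which makes the top visible in the
      -- action.
      (λ i → ,-injectiveʳ (eq (x , i)))
      where
      coords : ∀ i → insertAt ks j t i ≈ insertAt ls j u i
      coords i y = ,-injectiveˡ (eq (y , i))

    stabFamily : ∀ {ws TG TH} → AllPairs (λ v w → ¬ SameKey v w) ws →
      IsFinSubset (Stab G x) TG → IsFinSubset (Stab H j) TH →
      ∃[ T ] (IsFinSubset (Stab (Wreath G H) (x , j)) T ×
              length T ≡ length ws * (length TG * length TH))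
    stabFamily {ws} {TG} {TH} ws! (TG! , TG⊆) (TH! , TH⊆) = T , (T! , T⊆) , lengthT
      where
      T = cartesianProductWith stabElement (map key ws) (cartesianProduct TG TH)

      T! : AllPairs _≉_ T
      T! = Unique.cartesianProductWith⁺ (DecSetoid.setoid (keySetoid m p))
             (×-setoid (≈-setoid _) (≈-setoid _)) (≈-setoid _)
             stabElement (λ {ks ls th uk} → stabElement-injective {ks} {ls} {th} {uk}) (AllPairs.map⁺ ws!)
             (Unique.cartesianProduct⁺ (≈-setoid _) (≈-setoid _) TG! TH!)

      keys∈G : All (λ ks → ∀ i → G (ks i)) (map key ws)
      keys∈G = All.map⁺ (All.universal key∈G ws)

      T⊆ : All (Stab (Wreath G H) (x , j)) T
      T⊆ = All.cartesianProductWith⁺ (setoid _) (setoid _) stabElement _ _ λ k∈ th∈ →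
             let t∈ , h∈ = ∈-cartesianProduct⁻ TG TH th∈ in
             stabElement-mem (All.lookup keys∈G k∈) (All.lookup TG⊆ t∈) (All.lookup TH⊆ h∈)

      lengthT : length T ≡ length ws * (length TG * length TH)
      lengthT = trans (length-cartesianProductWith stabElement (map key ws) _)
        (cong₂ _*_ (length-map key ws) (length-cartesianProductWith _,_ TG TH))

  -- Bounding an intersecting family by a point stabilizer.

  ekr-elements : EKR G → EKR H → (ws : List Element) →
    AllPairs (_≉_ on proj₁) ws → AllPairs Meet ws →
    ∃[ ω ] ∃[ T ] (IsFinSubset (Stab (Wreath G H) ω) T × length ws ≤ length T)
  ekr-elements ekrG ekrH ws ws! meet =
    let j , TH , THfin , tops≤  = ekrH tops  tops-fin  tops-meet
        x , TG , TGfin , bases≤ = ekrG bases bases-fin bases-meet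
        T , Tfin , lengthT      = stabFamily x j K.reps-≁ TGfin THfin
    in (x , j) , T , Tfin , (begin
      length ws                                    ≤⟨ K.bound ⟩
      length K.reps * length K.class               ≤⟨ *-monoʳ-≤ (length K.reps) (begin
        length K.class                 ≤⟨ L.bound ⟩
        length L.reps * length L.class ≡⟨ cong₂ _*_ (length-map top L.reps) (length-map base L.class) ⟨
        length tops * length bases     ≤⟨ *-mono-≤ tops≤ bases≤ ⟩
        length TH * length TG          ≡⟨ *-comm (length TH) (length TG) ⟩
        length TG * length TH          ∎) ⟩
      length K.reps * (length TG * length TH)      ≡⟨ lengthT ⟨
      length T                                     ∎)
    where
    open ≤-Reasoning
    -- Two successive splittings: the family by key, then the chosen key class by top. `L.reps` have
    -- distinct tops and yield the subset of `H`; `L.class` shares key and top and yields the subset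
    -- of `G`. `K.reps` supplies the keys of the stabilizer family.
    module K = Pigeonhole (pigeonhole (On.decSetoid (keySetoid m p) key) ws)
    module L = Pigeonhole (pigeonhole (On.decSetoid (≈-decSetoid (suc p)) top) K.class)

    tops  = map top L.reps
    bases = map base L.class

    tops-fin : IsFinSubset H tops
    tops-fin = AllPairs.map⁺ L.reps-≁ , All.map⁺ (All.universal top∈H L.reps)

    tops-meet : IsIntersecting tops
    tops-meet = AllPairs.map⁺ (AllPairs.map (λ {v} {w} → top-intersect {v} {w})
      (AllPairs-resp-⊆ (⊆-trans L.reps-⊆ K.class-⊆) meet))

    sameKey : AllPairs SameKey L.class
    sameKey = AllPairs-resp-⊆ L.class-⊆ K.class-∼

    class-⊆ : L.class ⊆ ws
    class-⊆ = ⊆-trans L.class-⊆ K.class-⊆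

    bases-fin : IsFinSubset G bases
    bases-fin =
      AllPairs.map⁺ (AllPairs.map
        (λ {v} {w} (k , t , v≉w) b → v≉w (element-determined {v} {w} k t b))
        (AllPairs.zip (sameKey , AllPairs.zip (L.class-∼ , AllPairs-resp-⊆ class-⊆ ws!)))) ,
      All.map⁺ (All.universal base∈G L.class)

    bases-meet : IsIntersecting bases
    bases-meet = AllPairs.map⁺ (AllPairs.map
      (λ {v} {w} (k , vw) → base-intersect {v} {w} k vw)
      (AllPairs.zip (sameKey , AllPairs-resp-⊆ class-⊆ meet)))

theorem5p22 : (m n : ℕ) (G : Sym (Fin m) → Set) (H : Sym (Fin n) → Set) →
    IsSubgroup G → IsSubgroup H → EKR G → EKR H → EKR (Wreath G H)
-- For n = 0 the property of `H`, applied to the empty family, would produce a point of the empty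
-- set.
theorem5p22 m zero    G H G≤ H≤ ekrG ekrH with () ← proj₁ (ekrH [] ([] , []) [])
theorem5p22 m (suc p) G H G≤ H≤ ekrG ekrH S (S! , S⊆) meet =
  let ω , T , Tfin , ws≤ = ekr-elements G H G≤ ekrG ekrH ws
        (AllPairs.map⁻ (subst (AllPairs _≉_) (sym ws≡S) S!))
        (AllPairs.map⁻ (subst (AllPairs Intersect) (sym ws≡S) meet))
  in ω , T , Tfin , ≤-trans (≤-reflexive (trans (cong length (sym ws≡S)) (length-map proj₁ ws))) ws≤
  where
  -- Each permutation of `S` is paired with its own membership proof, which supplies the
  -- decomposition.
  ws   = All.toList S⊆
  ws≡S = All-toList S⊆
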